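{- For every graph $G$ with at least one edge, $wr(G)\le sr(G)\le \lceil (\Delta(G)+1)/2\rceil$, where $\Delta(G)$ is the maximum degree of $G$.
   Context: All graphs are finite, simple and undirected. For a set $E'$ of edges of a graph, the subgraph induced by $E'$ is the graph whose edge set is $E'$ and whose vertex set is the set of endpoints of edges in $E'$. A graph is weakly semiregular if there are two numbers $a,b$ (not necessarily distinct) such that the degree of every vertex is $a$ or $b$; $wr(G)$ is the minimum number of subsets into which $E(G)$ can be partitioned so that the subgraph induced by each subset is weakly semiregular. A graph is semiregular if there is an integer $d$ such that every vertex has degree $d$ or $d+1$; $sr(G)$ is the minimum number of subsets into which $E(G)$ can be partitioned so that the subgraph induced by each subset is semiregular. -}

module Defs where

open import Data.Fin using (Fin; zero; suc; punchIn; punchOut; combine; remQuot)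
  renaming (_<_ to _<ᶠ_)
open import Data.Fin.Properties
  using (all?; any?; ¬∀⟶∃¬; punchIn-injective; punchIn-punchOut;
         remQuot-combine; combine-remQuot; <-asym; <-irrefl; <-cmp)
  renaming (_≟_ to _≟ᶠ_; _<?_ to _<ᶠ?_)
open import Data.Fin.Subset using (Subset; _∈_; _∉_; Nonempty; ⁅_⁆; ∣_∣)
open import Data.Fin.Subset.Properties
  using (_∈?_; nonempty?; anySubset?; ∣p∣≤n; p⊆q⇒∣p∣≤∣q∣; ∣⁅x⁆∣≡1; x∈⁅y⁆⇒x≡y; x∈⁅x⁆)
open import Data.List using (List; filter; map; allFin)
open import Data.List.Extrema.Nat using (max)
open import Data.Nat using (ℕ; zero; suc; _*_; _≤_; _<_; z≤n; s≤s)
open import Data.Nat.Induction using (<-rec)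
open import Data.Nat.Properties
  using (_≟_; _≤?_; ≤-antisym; ≤-trans; ≤-refl; ≤-reflexive; ≮⇒≥; anyUpTo?; n≤1+n)
open import Data.Product using (Σ; ∃; ∃₂; _×_; _,_; proj₁; proj₂; ∃-syntax; Σ-syntax; map₂)
open import Data.Sum using (_⊎_; inj₁; inj₂; [_,_]′)
open import Data.Vec using (tabulate)
open import Data.Vec.Functional using () renaming ([] to []ᶠ; _∷_ to _∷ᶠ_)
open import Data.Vec.Properties using (lookup∘tabulate; lookup⇒[]=; []=⇒lookup; tabulate-cong)
open import Function using (_∘_; id)
open import Relation.Binary using (Rel; Reflexive; tri<; tri≈; tri>)
open import Relation.Binary.PropositionalEquality
  using (_≡_; _≗_; refl; sym; trans; cong; subst)
open import Relation.Nullary using (Dec; yes; no; does; contradiction)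
open import Relation.Nullary.Decidable
  using (map′; _×-dec_; _⊎-dec_; _→-dec_; dec-true)
open import Relation.Unary using (Pred; Decidable)
open import Level using (0ℓ)

-- The vertices form an arbitrary subset of an ambient set Fin n, so that the
-- subgraph induced by a set of edges is again a Graph n.
record Graph (n : ℕ) : Set where
  field
    vertices   : Subset n
    neighbours : Fin n → Subset n
    endpoint   : ∀ {u v} → v ∈ neighbours u → v ∈ vertices
    symmetric  : ∀ {u v} → v ∈ neighbours u → u ∈ neighbours v
    loopless   : ∀ {v} → v ∉ neighbours v

  Adj : Fin n → Fin n → Set
  Adj u v = v ∈ neighbours u

  deg : Fin n → ℕ
  deg v = ∣ neighbours v ∣

  HasEdge : Set
  HasEdge = ∃₂ Adj

  vertexList : List (Fin n)
  vertexList = filter (_∈? vertices) (allFin n)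

  Δ : ℕ
  Δ = max 0 (map deg vertexList)

open Graph public using (Adj; deg; HasEdge; Δ)
open Graph

WeaklySemiregular : ∀ {n} → Graph n → Set
WeaklySemiregular G =
  ∃₂ λ a b → ∀ v → v ∈ vertices G → deg G v ≡ a ⊎ deg G v ≡ b

-- An integer d = -1 would force all degrees to be 0, which d = 0 covers.
Semiregular : ∀ {n} → Graph n → Set
Semiregular G =
  ∃[ d ] ∀ v → v ∈ vertices G → deg G v ≡ d ⊎ deg G v ≡ suc d

comprehension : ∀ {n} {P : Pred (Fin n) 0ℓ} → Decidable P → Subset n
comprehension P? = tabulate (does ∘ P?)

∈-comprehension⁺ : ∀ {n} {P : Pred (Fin n) 0ℓ} (P? : Decidable P) {v} →
                   P v → v ∈ comprehension P?
∈-comprehension⁺ P? {v} p =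
  lookup⇒[]= v _ (trans (lookup∘tabulate (does ∘ P?) v) (dec-true (P? v) p))

∈-comprehension⁻ : ∀ {n} {P : Pred (Fin n) 0ℓ} (P? : Decidable P) {v} →
                   v ∈ comprehension P? → P v
∈-comprehension⁻ P? {v} v∈
  with P? v | trans (sym (lookup∘tabulate (does ∘ P?) v)) ([]=⇒lookup v∈)
... | yes p | _  = p
... | no _  | ()

-- A set of edges of G, given by its (symmetric) incidence: the edge uv belongs
-- to it iff v ∈ incident u.
record EdgeSet {n} (G : Graph n) : Set where
  field
    incident  : Fin n → Subset n
    isSubset  : ∀ {u v} → v ∈ incident u → Adj G u v
    symmetric : ∀ {u v} → v ∈ incident u → u ∈ incident v

open EdgeSet public using (incident)

induced : ∀ {n} {G : Graph n} → EdgeSet G → Graph n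
induced {G = G} E = record
  { vertices   = comprehension (λ v → nonempty? (incident E v))
  ; neighbours = incident E
  ; endpoint   = λ v∈ → ∈-comprehension⁺ (λ v → nonempty? (incident E v))
                          (_ , EdgeSet.symmetric E v∈)
  ; symmetric  = EdgeSet.symmetric E
  ; loopless   = λ v∈ → loopless G (EdgeSet.isSubset E v∈)
  }

record EdgePartition {n} (G : Graph n) (k : ℕ) : Set where
  field
    part     : Fin k → EdgeSet G
    nonempty : ∀ i → ∃₂ λ u v → v ∈ incident (part i) u
    covers   : ∀ u v → Adj G u v → ∃[ i ] v ∈ incident (part i) u
    disjoint : ∀ i j u v → v ∈ incident (part i) u → v ∈ incident (part j) u → i ≡ j

open EdgePartition public using (part)

PartitionsInto : ∀ {n} → Pred (Graph n) 0ℓ → Graph n → ℕ → Set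
PartitionsInto Q G k = Σ[ P ∈ EdgePartition G k ] ∀ i → Q (induced (part P i))

IsLeast : Pred ℕ 0ℓ → ℕ → Set
IsLeast P m = P m × (∀ k → P k → m ≤ k)

-- The rest shows that the minima defining wr and sr exist: the predicates are
-- decidable (by exhaustive search), and single edges always give a partition.

least : ∀ {P : Pred ℕ 0ℓ} → Decidable P → ∃ P → ∃ (IsLeast P)
least {P} P? (m , p) = <-rec (λ m → P m → ∃ (IsLeast P)) step m p
  where
  step : ∀ m → (∀ {k} → k < m → P k → ∃ (IsLeast P)) → P m → ∃ (IsLeast P)
  step m rec p with anyUpTo? P? m
  ... | yes (k , k<m , q) = rec k<m q
  ... | no none           = m , p , λ k q → ≮⇒≥ λ k<m → none (k , k<m , q)

-- Existence over A is decidable for decidable predicates that respect _≈_.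
Searchable : (A : Set) → Rel A 0ℓ → Set₁
Searchable A _≈_ = ∀ {P : Pred A 0ℓ} → Decidable P →
                   (∀ {x y} → x ≈ y → P x → P y) → Dec (∃ P)

search-→ : ∀ {A : Set} (_≈_ : Rel A 0ℓ) → Reflexive _≈_ → Searchable A _≈_ →
           ∀ k → Searchable (Fin k → A) (λ f g → ∀ i → f i ≈ g i)
search-→ _≈_ rfl s zero P? resp =
  map′ ([]ᶠ ,_) (λ (f , p) → resp {f} {[]ᶠ} (λ ()) p) (P? []ᶠ)
search-→ _≈_ rfl s (suc k) P? resp =
  map′ (λ (x , f , p) → x ∷ᶠ f , p)
       (λ (f , p) → f zero , f ∘ suc , resp (λ { zero → rfl ; (suc i) → rfl }) p)
       (s (λ x → search-→ _≈_ rfl s k (λ f → P? (x ∷ᶠ f))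
                   λ f≈g → resp λ { zero → rfl ; (suc i) → f≈g i })
          λ x≈y → map₂ (resp λ { zero → x≈y ; (suc i) → rfl }))

_≈ᴱ_ : ∀ {n} {G : Graph n} → Rel (EdgeSet G) 0ℓ
E ≈ᴱ F = incident E ≗ incident F

search-EdgeSet : ∀ {n} (G : Graph n) → Searchable (EdgeSet G) _≈ᴱ_
search-EdgeSet {n} G {P} P? resp =
  map′ (λ (f , e , p) → toEdgeSet f e , p)
       (λ (E , p) → incident E
                  , (λ u v → EdgeSet.isSubset E , EdgeSet.symmetric E)
                  , resp (λ _ → refl) p)
       (search-→ _≡_ refl (λ R? _ → anySubset? R?) n Q? Q-resp)
  where
  IsEdgeSet : Pred (Fin n → Subset n) 0ℓ
  IsEdgeSet f = ∀ u v → (v ∈ f u → Adj G u v) × (v ∈ f u → u ∈ f v)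

  toEdgeSet : ∀ f → IsEdgeSet f → EdgeSet G
  toEdgeSet f e = record
    { incident  = f
    ; isSubset  = λ {u} {v} → proj₁ (e u v)
    ; symmetric = λ {u} {v} → proj₂ (e u v)
    }

  Q : Pred (Fin n → Subset n) 0ℓ
  Q f = Σ[ e ∈ IsEdgeSet f ] P (toEdgeSet f e)

  Q? : Decidable Q
  Q? f with all? (λ u → all? λ v → (v ∈? f u →-dec v ∈? neighbours G u)
                             ×-dec (v ∈? f u →-dec u ∈? f v))
  ... | no ¬e = no (¬e ∘ proj₁)
  ... | yes e = map′ (e ,_) (λ (_ , p) → resp (λ _ → refl) p) (P? (toEdgeSet f e))

  Q-resp : ∀ {f g} → f ≗ g → Q f → Q g
  Q-resp {f} {g} f≗g (e , p) = e′ , resp f≗g p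
    where
    e′ : IsEdgeSet g
    e′ u v = (λ v∈ → proj₁ (e u v) (subst (v ∈_) (sym (f≗g u)) v∈))
           , (λ v∈ → subst (u ∈_) (f≗g v)
                       (proj₂ (e u v) (subst (v ∈_) (sym (f≗g u)) v∈)))

module _ {n} (Q : Pred (Graph n) 0ℓ) (Q? : Decidable Q)
         (Q-resp : ∀ {G H} → vertices G ≡ vertices H →
                   neighbours G ≗ neighbours H → Q G → Q H)
         (G : Graph n) where

  partitionsInto? : Decidable (PartitionsInto Q G)
  partitionsInto? k =
    map′ (λ (f , ne , cov , dis , q) →
            record { part = f ; nonempty = ne ; covers = cov ; disjoint = dis } , q)
         (λ (P , q) → part P , EdgePartition.nonempty P , EdgePartition.covers P
                    , EdgePartition.disjoint P , q)
         (search-→ _≈ᴱ_ (λ {E} _ → refl {x = incident E _}) (search-EdgeSet G) k R? (λ {f} {g} → R-resp {f} {g}))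
    where
    R : Pred (Fin k → EdgeSet G) 0ℓ
    R f = (∀ i → ∃₂ λ u v → v ∈ incident (f i) u)
        × (∀ u v → Adj G u v → ∃[ i ] v ∈ incident (f i) u)
        × (∀ i j u v → v ∈ incident (f i) u → v ∈ incident (f j) u → i ≡ j)
        × (∀ i → Q (induced (f i)))

    R? : Decidable R
    R? f =
      all? (λ i → any? λ u → any? λ v → v ∈? incident (f i) u)
      ×-dec all? (λ u → all? λ v →
              v ∈? neighbours G u →-dec any? λ i → v ∈? incident (f i) u)
      ×-dec all? (λ i → all? λ j → all? λ u → all? λ v →
              v ∈? incident (f i) u →-dec (v ∈? incident (f j) u →-dec i ≟ᶠ j))
      ×-dec all? (λ i → Q? (induced (f i)))

    R-resp : ∀ {f g} → (∀ i → f i ≈ᴱ g i) → R f → R g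
    R-resp {f} {g} f≈g (ne , cov , dis , q) =
        (λ i → map₂ (map₂ to) (ne i))
      , (λ u v a → map₂ to (cov u v a))
      , (λ i j u v p p′ → dis i j u v (from p) (from p′))
      , λ i → Q-resp {induced (f i)} {induced (g i)}
                (tabulate-cong λ v → cong (λ S → does (nonempty? S)) (f≈g i v))
                (f≈g i) (q i)
      where
      to : ∀ {i u v} → v ∈ incident (f i) u → v ∈ incident (g i) u
      to {i} {u} {v} = subst (v ∈_) (f≈g i u)
      from : ∀ {i u v} → v ∈ incident (g i) u → v ∈ incident (f i) u
      from {i} {u} {v} = subst (v ∈_) (sym (f≈g i u))

-- Empty parts can be discarded.
prune : ∀ {n} {Q : Pred (Graph n) 0ℓ} {G : Graph n} k (f : Fin k → EdgeSet G) →
        (∀ u v → Adj G u v → ∃[ i ] v ∈ incident (f i) u) →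
        (∀ i j u v → v ∈ incident (f i) u → v ∈ incident (f j) u → i ≡ j) →
        (∀ i → Q (induced (f i))) →
        ∃[ m ] m ≤ k × PartitionsInto Q G m
prune k f cov dis q
  with all? (λ i → any? λ u → any? λ v → v ∈? incident (f i) u)
... | yes ne = k , ≤-refl
             , record { part = f ; nonempty = ne ; covers = cov ; disjoint = dis } , q
prune zero f cov dis q | no ¬ne = contradiction (λ ()) ¬ne
prune {Q = Q} {G} (suc k) f cov dis q | no ¬ne
  with ¬∀⟶∃¬ _ _ (λ i → any? λ u → any? λ v → v ∈? incident (f i) u) ¬ne
... | i , empty =
  let (m , m≤k , r) = prune {Q = Q} {G} k (f ∘ punchIn i) cov′
                        (λ j l u v p p′ → punchIn-injective i j l (dis _ _ u v p p′))
                        (q ∘ punchIn i)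
  in m , ≤-trans m≤k (n≤1+n k) , r
  where
  cov′ : ∀ u v → Adj G u v → ∃[ j ] v ∈ incident (f (punchIn i j)) u
  cov′ u v a with cov u v a
  ... | j , v∈ with i ≟ᶠ j
  ...   | yes refl = contradiction (u , v , v∈) empty
  ...   | no i≢j   = punchOut i≢j
                   , subst (λ l → v ∈ incident (f l) u) (sym (punchIn-punchOut i≢j)) v∈

module _ {n} (G : Graph n) where

  private
    IsEdge : Fin n × Fin n → Fin n → Fin n → Set
    IsEdge (a , b) u v =
      a <ᶠ b × Adj G a b × ((u ≡ a × v ≡ b) ⊎ (u ≡ b × v ≡ a))

    isEdge? : ∀ e u → Decidable (IsEdge e u)
    isEdge? (a , b) u v =
      a <ᶠ? b ×-dec b ∈? neighbours G a
      ×-dec ((u ≟ᶠ a ×-dec v ≟ᶠ b) ⊎-dec (u ≟ᶠ b ×-dec v ≟ᶠ a))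

    swap : ∀ e {u v} → IsEdge e u v → IsEdge e v u
    swap _ (lt , a , inj₁ (p , q)) = lt , a , inj₂ (q , p)
    swap _ (lt , a , inj₂ (p , q)) = lt , a , inj₁ (q , p)

    isEdge⇒adj : ∀ e {u v} → IsEdge e u v → Adj G u v
    isEdge⇒adj _ (_ , a , inj₁ (refl , refl)) = a
    isEdge⇒adj _ (_ , a , inj₂ (refl , refl)) = symmetric G a

    isEdge-unique : ∀ e e′ {u v} → IsEdge e u v → IsEdge e′ u v → e ≡ e′
    isEdge-unique _ _ (_ , _ , inj₁ (refl , refl)) (_ , _ , inj₁ (refl , refl)) = refl
    isEdge-unique _ _ (p , _ , inj₁ (refl , refl)) (q , _ , inj₂ (refl , refl)) =
      contradiction q (<-asym p)
    isEdge-unique _ _ (p , _ , inj₂ (refl , refl)) (q , _ , inj₁ (refl , refl)) =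
      contradiction q (<-asym p)
    isEdge-unique _ _ (_ , _ , inj₂ (refl , refl)) (_ , _ , inj₂ (refl , refl)) = refl

    isEdge-functional : ∀ e {u v w} → IsEdge e u v → IsEdge e u w → v ≡ w
    isEdge-functional _ (_ , _ , inj₁ (refl , refl)) (_ , _ , inj₁ (_ , refl)) = refl
    isEdge-functional _ (p , _ , inj₁ (refl , refl)) (_ , _ , inj₂ (refl , refl)) =
      contradiction p (<-irrefl refl)
    isEdge-functional _ (p , _ , inj₂ (refl , refl)) (_ , _ , inj₁ (refl , refl)) =
      contradiction p (<-irrefl refl)
    isEdge-functional _ (_ , _ , inj₂ (refl , refl)) (_ , _ , inj₂ (_ , refl)) = refl

    single : Fin n × Fin n → EdgeSet G
    single e = record
      { incident  = λ u → comprehension (isEdge? e u)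
      ; isSubset  = λ {u} v∈ → isEdge⇒adj e (∈-comprehension⁻ (isEdge? e u) v∈)
      ; symmetric = λ {u} {v} v∈ → ∈-comprehension⁺ (isEdge? e v)
                      (swap e (∈-comprehension⁻ (isEdge? e u) v∈))
      }

    single-semiregular : ∀ e → Semiregular (induced (single e))
    single-semiregular e = 1 , λ v v∈ → inj₁ (degree-one v
      (∈-comprehension⁻ (λ v → nonempty? (incident (single e) v)) v∈))
      where
      degree-one : ∀ v → Nonempty (incident (single e) v) →
                   ∣ incident (single e) v ∣ ≡ 1
      degree-one v (w , w∈) = trans
        (≤-antisym
          (p⊆q⇒∣p∣≤∣q∣ λ x∈ → subst (_∈ ⁅ w ⁆)
            (isEdge-functional e (∈-comprehension⁻ (isEdge? e v) w∈)
                                 (∈-comprehension⁻ (isEdge? e v) x∈))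
            (x∈⁅x⁆ w))
          (p⊆q⇒∣p∣≤∣q∣ λ x∈ → subst (_∈ incident (single e) v)
            (sym (x∈⁅y⁆⇒x≡y w x∈)) w∈))
        (∣⁅x⁆∣≡1 w)

  semiregularPartition : ∃ (PartitionsInto Semiregular G)
  semiregularPartition =
    let (m , _ , r) = prune {Q = Semiregular} {G} (n * n) (single ∘ remQuot n) cov dis
                        (single-semiregular ∘ remQuot n)
    in m , r
    where
    cov : ∀ u v → Adj G u v → ∃[ i ] v ∈ incident (single (remQuot n i)) u
    cov u v adj with <-cmp u v
    ... | tri≈ _ refl _ = contradiction adj (loopless G)
    ... | tri< u<v _ _ = combine u v ,
      subst (λ e → v ∈ incident (single e) u) (sym (remQuot-combine u v))
        (∈-comprehension⁺ (isEdge? (u , v) u) (u<v , adj , inj₁ (refl , refl)))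
    ... | tri> _ _ v<u = combine v u ,
      subst (λ e → v ∈ incident (single e) u) (sym (remQuot-combine v u))
        (∈-comprehension⁺ (isEdge? (v , u) u)
          (v<u , symmetric G adj , inj₂ (refl , refl)))

    dis : ∀ i j u v → v ∈ incident (single (remQuot n i)) u →
          v ∈ incident (single (remQuot n j)) u → i ≡ j
    dis i j u v p q = trans (sym (combine-remQuot {n} n i)) (trans
      (cong (λ (a , b) → combine a b)
        (isEdge-unique (remQuot n i) (remQuot n j)
          (∈-comprehension⁻ (isEdge? (remQuot n i) u) p)
          (∈-comprehension⁻ (isEdge? (remQuot n j) u) q)))
      (combine-remQuot {n} n j))

semiregular⇒weaklySemiregular : ∀ {n} {G : Graph n} → Semiregular G → WeaklySemiregular G
semiregular⇒weaklySemiregular (d , h) = d , suc d , h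

semiregular? : ∀ {n} → Decidable (Semiregular {n})
semiregular? {n} G =
  map′ (λ (d , _ , h) → d , h) bound
       (anyUpTo? (λ d → all? λ v → v ∈? vertices G →-dec
                          (deg G v ≟ d ⊎-dec deg G v ≟ suc d)) (suc n))
  where
  bound : Semiregular G →
          ∃[ d ] d < suc n × (∀ v → v ∈ vertices G → deg G v ≡ d ⊎ deg G v ≡ suc d)
  bound (d , h) with d ≤? n
  ... | yes d≤n = d , s≤s d≤n , h
  ... | no d≰n = 0 , s≤s z≤n , λ v v∈ →
    contradiction (≤-trans ([ (λ eq → ≤-reflexive (sym eq))
                            , (λ eq → ≤-trans (n≤1+n d) (≤-reflexive (sym eq))) ]′ (h v v∈))
                           (∣p∣≤n (neighbours G v)))
                  d≰n

weaklySemiregular? : ∀ {n} → Decidable (WeaklySemiregular {n})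
weaklySemiregular? {n} G =
  map′ (λ (a , _ , b , _ , h) → a , b , h) bound
       (anyUpTo? (λ a → anyUpTo? (λ b → all? λ v → v ∈? vertices G →-dec
                          (deg G v ≟ a ⊎-dec deg G v ≟ b)) (suc n)) (suc n))
  where
  clamp : ∀ a → ∃[ a′ ] a′ < suc n × (∀ v → deg G v ≡ a → deg G v ≡ a′)
  clamp a with a ≤? n
  ... | yes a≤n = a , s≤s a≤n , λ _ → id
  ... | no a≰n  = 0 , s≤s z≤n , λ v eq →
    contradiction (subst (_≤ n) eq (∣p∣≤n (neighbours G v))) a≰n

  bound : WeaklySemiregular G →
          ∃[ a ] a < suc n × ∃[ b ] b < suc n ×
            (∀ v → v ∈ vertices G → deg G v ≡ a ⊎ deg G v ≡ b)
  bound (a , b , h) =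
    let (a′ , a′< , f) = clamp a
        (b′ , b′< , g) = clamp b
    in a′ , a′< , b′ , b′< , λ v v∈ → [ inj₁ ∘ f v , inj₂ ∘ g v ]′ (h v v∈)

module _ {n} {G H : Graph n}
         (V≡ : vertices G ≡ vertices H) (N≗ : neighbours G ≗ neighbours H) where

  semiregular-resp : Semiregular G → Semiregular H
  semiregular-resp (d , h) = d , λ v v∈ →
    subst (λ S → ∣ S ∣ ≡ d ⊎ ∣ S ∣ ≡ suc d) (N≗ v) (h v (subst (v ∈_) (sym V≡) v∈))

  weaklySemiregular-resp : WeaklySemiregular G → WeaklySemiregular H
  weaklySemiregular-resp (a , b , h) = a , b , λ v v∈ →
    subst (λ S → ∣ S ∣ ≡ a ⊎ ∣ S ∣ ≡ b) (N≗ v) (h v (subst (v ∈_) (sym V≡) v∈))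

leastSemiregular : ∀ {n} (G : Graph n) → ∃ (IsLeast (PartitionsInto Semiregular G))
leastSemiregular G =
  least (partitionsInto? Semiregular semiregular?
           (λ {G} {H} → semiregular-resp {G = G} {H}) G)
        (semiregularPartition G)

leastWeaklySemiregular : ∀ {n} (G : Graph n) →
                         ∃ (IsLeast (PartitionsInto WeaklySemiregular G))
leastWeaklySemiregular G =
  least (partitionsInto? WeaklySemiregular weaklySemiregular?
           (λ {G} {H} → weaklySemiregular-resp {G = G} {H}) G)
        (let (m , P , q) = semiregularPartition G
         in m , P , λ i → semiregular⇒weaklySemiregular {G = induced (part P i)} (q i))

wr : ∀ {n} → Graph n → ℕ
wr G = proj₁ (leastWeaklySemiregular G)

sr : ∀ {n} → Graph n → ℕ
sr G = proj₁ (leastSemiregular G)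

{-# OPTIONS --safe #-}
module Submission where

-- A list of edges has an orientation in which in- and outdegree differ by at most
-- one at every vertex: replace two edges uv, vw by uw, orient the shorter list, and
-- route the orientation of uw through v. With degrees at most Δ, this makes all in-
-- and outdegrees at most k = ⌈(Δ+1)/2⌉, so the arcs form a bipartite graph of maximum
-- degree at most k (tails on the left, heads on the right), which by König's theorem
-- is properly k-edge-coloured. Then every colour class has in- and outdegrees at most
-- one in G, hence degrees 1 and 2 only.
--
-- König's theorem follows from the same orientation lemma. To insert an edge ab with
-- α missing at a and β missing at b, colour it α; the edges coloured α or β now form
-- a bipartite graph of maximum degree at most 2. In a balanced orientation of it,
-- recolour the edges directed left to right with α and the others with β: at each
-- vertex the two colours occur equally often up to one, hence at most once each.

open import Defs
open import Data.Bool using (if_then_else_)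
open import Data.Fin using (Fin; zero; suc) renaming (_<_ to _<ᶠ_)
import Data.Fin.Properties as Fin
open import Data.Fin.Subset
  using (Subset; _∈_; ∣_∣; ⁅_⁆; _∪_; _-_; ⊤; ⊥; inside; outside)
open import Data.Fin.Subset.Properties
  using (_∈?_; nonempty?; Empty-unique; p⊆q⇒∣p∣≤∣q∣; ∣⊤∣≡n; ∣⊥∣≡0; ∪-identityˡ;
         x∈⁅x⁆; x∈p∪q⁺; x∈p∧x≢y⇒x∈p-y; x∈p⇒∣p-x∣<∣p∣)
open import Data.List
  using (List; []; _∷_; _++_; length; map; foldr; replicate; filter; allFin;
         cartesianProduct)
open import Data.List.Extrema.Nat using (xs≤max)
import Data.List.Membership.Propositional as List
open import Data.List.Membership.Propositional.Properties
  using (∈-++⁺ʳ; ∈-map⁺; ∈-filter⁺; ∈-allFin; ∈-cartesianProduct⁺)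
open import Data.List.Properties using (length-++; length-replicate)
open import Data.List.Relation.Unary.All as All using (All; []; _∷_)
open import Data.List.Relation.Unary.All.Properties using (all-filter)
open import Data.List.Relation.Unary.AllPairs using ([]; _∷_)
open import Data.List.Relation.Unary.Any as Any using (Any; here; there)
open import Data.List.Relation.Unary.Unique.Propositional using (Unique)
import Data.List.Relation.Unary.Unique.Propositional.Properties as Unique
open import Data.Nat using (ℕ; zero; suc; _+_; _≤_; _<_; z≤n; s≤s; ⌈_/2⌉; ⌊_/2⌋)
open import Data.Nat.Properties
open import Algebra.Properties.CommutativeSemigroup +-commutativeSemigroup
  using (interchange; x∙yz≈y∙xz; xy∙z≈zy∙x)
open import Data.Product using (_×_; _,_; ∃; ∃-syntax; proj₁; proj₂)
open import Data.Sum using (_⊎_; inj₁; inj₂; swap)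
open import Data.Sum.Properties using (≡-dec)
open import Data.Vec using (_∷_)
open import Function using (_∘_; mk⇔)
open import Relation.Binary using (DecidableEquality; tri<; tri≈; tri>)
open import Relation.Binary.PropositionalEquality
  using (_≡_; _≢_; refl; sym; trans; cong; cong₂; subst; subst₂; module ≡-Reasoning)
open import Relation.Nullary using (¬_; Dec; yes; no; does; contradiction)
open import Relation.Nullary.Decidable as Dec
  using (_×-dec_; _⊎-dec_; does-⇔; dec-true; dec-false)

-- Almost equal pairs of numbers

Balanced : ℕ → ℕ → Set
Balanced a b = a ≤ suc b × b ≤ suc a

balanced-sym : ∀ {a b} → Balanced a b → Balanced b a
balanced-sym (p , q) = q , p

balanced-+ : ∀ c {a b} → Balanced a b → Balanced (c + a) (c + b)
balanced-+ zero    p       = p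
balanced-+ (suc c) p with q , r ← balanced-+ c p = s≤s q , s≤s r

-- Two on one side would force at least one on the other, hence a total of three.
balanced⇒≤1 : ∀ {a b} → Balanced a b → a + b ≤ 2 → a ≤ 1
balanced⇒≤1 {a} {b} (a≤1+b , _) a+b≤2 = ≮⇒≥ λ 2≤a →
  <⇒≱ (+-mono-≤ 2≤a (≤-pred (≤-trans 2≤a a≤1+b))) a+b≤2

-- Balance gives 2a ≤ a + b + 1 ≤ d + 1, which is then halved.
balanced⇒≤half : ∀ {a b d} → Balanced a b → a + b ≤ d → a ≤ ⌈ suc d /2⌉
balanced⇒≤half {a} {b} {d} (a≤1+b , _) a+b≤d = begin
  a                 ≡⟨ n≡⌊n+n/2⌋ a ⟩
  ⌊ a + a /2⌋       ≤⟨ ⌊n/2⌋-mono (+-monoʳ-≤ a a≤1+b) ⟩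
  ⌊ a + suc b /2⌋   ≡⟨ cong ⌊_/2⌋ (+-suc a b) ⟩
  ⌊ suc (a + b) /2⌋ ≤⟨ ⌊n/2⌋-mono (s≤s a+b≤d) ⟩
  ⌊ suc d /2⌋       ≤⟨ ⌊n/2⌋≤⌈n/2⌉ (suc d) ⟩
  ⌈ suc d /2⌉       ∎
  where open ≤-Reasoning

-- Balanced orientations

module Orientation {V : Set} (_≟ⱽ_ : DecidableEquality V) where

  δ : V → V → ℕ
  δ x y = if does (x ≟ⱽ y) then 1 else 0

  δ-refl : ∀ x → δ x x ≡ 1
  δ-refl x with x ≟ⱽ x
  ... | yes _  = refl
  ... | no x≢x = contradiction refl x≢x

  -- inj₁ x counts the edges leaving x, and inj₂ x the edges entering x.
  half : V ⊎ V → V × V → ℕ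
  half (inj₁ x) (a , _) = δ x a
  half (inj₂ x) (_ , b) = δ x b

  halfdeg : V ⊎ V → List (V × V) → ℕ
  halfdeg s []       = 0
  halfdeg s (e ∷ es) = half s e + halfdeg s es

  out into degree : V → List (V × V) → ℕ
  out x       = halfdeg (inj₁ x)
  into x      = halfdeg (inj₂ x)
  degree x es = out x es + into x es

  infix 4 _↝_
  -- Lists of pairs stand for multigraphs, because replacing a path by an edge may create loops and
  -- parallel edges.
  data _↝_ : List (V × V) → List (V × V) → Set where
    []   : [] ↝ []
    keep : ∀ {e es os} → es ↝ os → e ∷ es ↝ e ∷ os
    flip : ∀ {a b es os} → es ↝ os → (a , b) ∷ es ↝ (b , a) ∷ os

  degree-↝ : ∀ x {es os} → es ↝ os → degree x os ≡ degree x es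
  degree-↝ x []       = refl
  degree-↝ x (keep {a , b} {es} {os} r) =
    trans (interchange (δ x a) (out x os) (δ x b) (into x os))
          (trans (cong (δ x a + δ x b +_) (degree-↝ x r))
                 (interchange (δ x a) (δ x b) (out x es) (into x es)))
  degree-↝ x (flip {a} {b} {es} {os} r) =
    trans (interchange (δ x b) (out x os) (δ x a) (into x os))
          (trans (cong₂ _+_ (+-comm (δ x b) (δ x a)) (degree-↝ x r))
                 (interchange (δ x a) (δ x b) (out x es) (into x es)))

  -- With an edge uv set aside, shifting one end of another edge vw from `v` to `u` replaces the
  -- path uvw by the edge uw.
  data Reattach (v u : V) : List (V × V) → List (V × V) → Set where
    source : ∀ {w es} → Reattach v u ((v , w) ∷ es) ((u , w) ∷ es)
    target : ∀ {w es} → Reattach v u ((w , v) ∷ es) ((w , u) ∷ es)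
    there  : ∀ {e es es′} → Reattach v u es es′ → Reattach v u (e ∷ es) (e ∷ es′)

  length-reattach : ∀ {v u es es′} → Reattach v u es es′ → length es′ ≡ length es
  length-reattach source    = refl
  length-reattach target    = refl
  length-reattach (there r) = cong suc (length-reattach r)

  reattach? : ∀ v u es → ∃ (Reattach v u es) ⊎ degree v es ≡ 0
  reattach? v u [] = inj₂ refl
  reattach? v u ((a , b) ∷ es) with v ≟ⱽ a | v ≟ⱽ b | reattach? v u es
  ... | yes refl | _        | _            = inj₁ (_ , source)
  ... | no _     | yes refl | _            = inj₁ (_ , target)
  ... | no _     | no _     | inj₁ (_ , r) = inj₁ (_ , there r)
  ... | no _     | no _     | inj₂ d≡0     = inj₂ d≡0

  -- Passing from `os′` to `os` moves one half-edge on the side of `s` from `u` to `v` and leaves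
  -- the side of `t` alone. `half s (u , u)` is the indicator of `u` on either side; adding
  -- indicators avoids subtraction.
  Moved : V → V → V ⊎ V → V ⊎ V → List (V × V) → List (V × V) → Set
  Moved v u s t os os′ =
    halfdeg s os + half s (u , u) ≡ halfdeg s os′ + half s (v , v)
      × halfdeg t os ≡ halfdeg t os′

  Restored : V → V → List (V × V) → List (V × V) → Set
  Restored v u os os′ =
    (∀ x → Moved v u (inj₁ x) (inj₂ x) os os′) ⊎ (∀ x → Moved v u (inj₂ x) (inj₁ x) os os′)

  moved-∷ : ∀ {v u os os′} e s t → Moved v u s t os os′ → Moved v u s t (e ∷ os) (e ∷ os′)
  moved-∷ e s t (p , q) =
      trans (+-assoc (half s e) _ _)
            (trans (cong (half s e +_) p) (sym (+-assoc (half s e) _ _)))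
    , cong (half t e +_) q

  restored-∷ : ∀ {v u os os′} e → Restored v u os os′ → Restored v u (e ∷ os) (e ∷ os′)
  restored-∷ {os = os} {os′} e (inj₁ m) =
    inj₁ λ x → moved-∷ {os = os} {os′} e (inj₁ x) (inj₂ x) (m x)
  restored-∷ {os = os} {os′} e (inj₂ m) =
    inj₂ λ x → moved-∷ {os = os} {os′} e (inj₂ x) (inj₁ x) (m x)

  -- The restored edge keeps the direction of the reattached one. The two cases of `Restored` say
  -- whether it leaves or enters `v`.
  restore : ∀ {v u es es′ os′} → Reattach v u es es′ → es′ ↝ os′ →
            ∃ λ os → es ↝ os × Restored v u os os′
  restore {v} {u} (source {w}) (keep {os = os} r) =
    (v , w) ∷ os , keep r , inj₁ λ x → xy∙z≈zy∙x (δ x v) (out x os) (δ x u) , refl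
  restore {v} {u} (source {w}) (flip {os = os} r) =
    (w , v) ∷ os , flip r , inj₂ λ x → xy∙z≈zy∙x (δ x v) (into x os) (δ x u) , refl
  restore {v} {u} (target {w}) (keep {os = os} r) =
    (w , v) ∷ os , keep r , inj₂ λ x → xy∙z≈zy∙x (δ x v) (into x os) (δ x u) , refl
  restore {v} {u} (target {w}) (flip {os = os} r) =
    (v , w) ∷ os , flip r , inj₁ λ x → xy∙z≈zy∙x (δ x v) (out x os) (δ x u) , refl
  restore (there p) (keep {e} {os = os′} r) with os , r′ , m ← restore p r =
    e ∷ os , keep r′ , restored-∷ {os = os} {os′} e m
  restore (there p) (flip {a} {b} {os = os′} r) with os , r′ , m ← restore p r =
    (b , a) ∷ os , flip r′ , restored-∷ {os = os} {os′} (b , a) m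

  BalancedOrientation : List (V × V) → Set
  BalancedOrientation es = ∃ λ os → es ↝ os × (∀ x → Balanced (out x os) (into x os))

  -- If the restored edge leaves `v`, the edge set aside is directed into `v`, otherwise out of it.
  -- Compared with `os′`, both out- and indegree then grow by one at `v` and are unchanged
  -- elsewhere.
  orient-contracted : ∀ {u v es es′} → Reattach v u es es′ →
                      BalancedOrientation es′ → BalancedOrientation ((u , v) ∷ es)
  orient-contracted {u} {v} r (os′ , o′ , bal) with restore r o′
  ... | os , o , inj₁ m = (u , v) ∷ os , keep o , λ x →
    subst₂ Balanced (trans (+-comm (δ x v) _) (trans (sym (proj₁ (m x))) (+-comm _ (δ x u))))
                    (cong (δ x v +_) (sym (proj₂ (m x))))
                    (balanced-+ (δ x v) (bal x))
  ... | os , o , inj₂ m = (v , u) ∷ os , flip o , λ x →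
    subst₂ Balanced (cong (δ x v +_) (sym (proj₂ (m x))))
                    (trans (+-comm (δ x v) _) (trans (sym (proj₁ (m x))) (+-comm _ (δ x u))))
                    (balanced-+ (δ x v) (bal x))

  -- `f` and `g` are out- and indegree, in the order given by the direction of the new edge. At `v`
  -- the counts become 0 and 1, and at `u` the count that is not larger grows. If the two vertices
  -- coincide, the edge is a loop and both counts grow.
  balanced-pendant : ∀ {u v} {f g : V → ℕ} → f v + g v ≡ 0 → f u ≤ g u →
                     (∀ x → Balanced (f x) (g x)) →
                     ∀ x → Balanced (δ x u + f x) (δ x v + g x)
  balanced-pendant {u} {v} {f} {g} fv+gv≡0 fu≤gu bal x with x ≟ⱽ v | x ≟ⱽ u
  ... | yes refl | yes refl = balanced-+ 1 (bal x)
  ... | yes refl | no _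
    rewrite m+n≡0⇒m≡0 (f x) fv+gv≡0 | m+n≡0⇒n≡0 (f x) fv+gv≡0 = z≤n , s≤s z≤n
  ... | no _     | yes refl = s≤s fu≤gu , ≤-trans (proj₂ (bal x)) (n≤1+n _)
  ... | no _     | no _     = bal x

  orient-pendant : ∀ {u v} es → degree v es ≡ 0 →
                   BalancedOrientation es → BalancedOrientation ((u , v) ∷ es)
  orient-pendant {u} {v} es d≡0 (os , o , bal) with ≤-total (out u os) (into u os)
  ... | inj₁ le = (u , v) ∷ os , keep o ,
    balanced-pendant (trans (degree-↝ v o) d≡0) le bal
  ... | inj₂ ge = (v , u) ∷ os , flip o , λ x → balanced-sym
    (balanced-pendant (trans (+-comm (into v os) _) (trans (degree-↝ v o) d≡0)) ge
                      (balanced-sym ∘ bal) x)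

  -- A reattached list is not a tail of the given one, so the induction is on a bound for the
  -- length.
  orient : ∀ n es → length es ≤ n → BalancedOrientation es
  orient _ [] _ = [] , [] , λ _ → z≤n , z≤n
  orient (suc n) ((u , v) ∷ es) (s≤s le) with reattach? v u es
  ... | inj₁ (es′ , r) =
    orient-contracted r (orient n es′ (subst (_≤ n) (sym (length-reattach r)) le))
  ... | inj₂ d≡0 = orient-pendant es d≡0 (orient n es le)

  balancedOrientation : ∀ es → BalancedOrientation es
  balancedOrientation es = orient (length es) es ≤-refl

-- König's edge colouring theorem

∣⁅x⁆∪p∣≤1+∣p∣ : ∀ {n} (x : Fin n) p → ∣ ⁅ x ⁆ ∪ p ∣ ≤ suc ∣ p ∣
∣⁅x⁆∪p∣≤1+∣p∣ zero    (inside  ∷ p) rewrite ∪-identityˡ p = n≤1+n _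
∣⁅x⁆∪p∣≤1+∣p∣ zero    (outside ∷ p) rewrite ∪-identityˡ p = ≤-refl
∣⁅x⁆∪p∣≤1+∣p∣ (suc x) (inside  ∷ p) = s≤s (∣⁅x⁆∪p∣≤1+∣p∣ x p)
∣⁅x⁆∪p∣≤1+∣p∣ (suc x) (outside ∷ p) = ∣⁅x⁆∪p∣≤1+∣p∣ x p

p⊆xs⇒∣p∣≤length : ∀ {n} {p : Subset n} xs → (∀ {x} → x ∈ p → x List.∈ xs) → ∣ p ∣ ≤ length xs
p⊆xs⇒∣p∣≤length xs p⊆xs = ≤-trans (p⊆q⇒∣p∣≤∣q∣ (∈-elements⁺ ∘ p⊆xs)) (∣elements∣≤length xs)
  where
  elements : ∀ {n} → List (Fin n) → Subset n
  elements = foldr (λ x p → ⁅ x ⁆ ∪ p) ⊥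

  ∈-elements⁺ : ∀ {n} {x : Fin n} {xs} → x List.∈ xs → x ∈ elements xs
  ∈-elements⁺ {x = x} (here refl)  = x∈p∪q⁺ (inj₁ (x∈⁅x⁆ x))
  ∈-elements⁺         (there x∈xs) = x∈p∪q⁺ (inj₂ (∈-elements⁺ x∈xs))

  ∣elements∣≤length : ∀ {n} (xs : List (Fin n)) → ∣ elements xs ∣ ≤ length xs
  ∣elements∣≤length {n} []   = ≤-reflexive (∣⊥∣≡0 n)
  ∣elements∣≤length (x ∷ xs) = ≤-trans (∣⁅x⁆∪p∣≤1+∣p∣ x _) (s≤s (∣elements∣≤length xs))

module EdgeColouring {V : Set} (_≟ⱽ_ : DecidableEquality V) (k : ℕ) where
  open Orientation _≟ⱽ_ using (δ; δ-refl; half; halfdeg)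
  module Bipartite = Orientation (≡-dec _≟ⱽ_ _≟ⱽ_)
  open Bipartite using (_↝_; []; keep; flip)

  -- An entry `(c , a , b)` is an edge of colour `c` from the left copy of `a` to the right copy of
  -- `b`. Thus `V ⊎ V` is the vertex set of a bipartite multigraph in which `halfdeg` is the degree.
  Colouring : Set
  Colouring = List (Fin k × (V × V))

  edges : Colouring → List (V × V)
  edges = map proj₂

  class : Fin k → Colouring → List (V × V)
  class γ []             = []
  class γ ((c , e) ∷ cs) = if does (γ Fin.≟ c) then e ∷ class γ cs else class γ cs

  load : Fin k → V ⊎ V → Colouring → ℕ
  load γ s cs = halfdeg s (class γ cs)

  load-≡ : ∀ γ s e cs → load γ s ((γ , e) ∷ cs) ≡ half s e + load γ s cs
  load-≡ γ s e cs with γ Fin.≟ γ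
  ... | yes _  = refl
  ... | no γ≢γ = contradiction refl γ≢γ

  load-≢ : ∀ {γ c} → γ ≢ c → ∀ s e cs → load γ s ((c , e) ∷ cs) ≡ load γ s cs
  load-≢ {γ} {c} γ≢c s e cs with γ Fin.≟ c
  ... | yes γ≡c = contradiction γ≡c γ≢c
  ... | no _    = refl

  coloursAt : V ⊎ V → Colouring → List (Fin k)
  coloursAt s []             = []
  coloursAt s ((c , e) ∷ cs) = replicate (half s e) c ++ coloursAt s cs

  length-coloursAt : ∀ s cs → length (coloursAt s cs) ≡ halfdeg s (edges cs)
  length-coloursAt s []             = refl
  length-coloursAt s ((c , e) ∷ cs) =
    trans (length-++ (replicate (half s e) c))
          (cong₂ _+_ (length-replicate (half s e)) (length-coloursAt s cs))

  ∈-coloursAt : ∀ {γ} s cs → load γ s cs ≢ 0 → γ List.∈ coloursAt s cs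
  ∈-coloursAt s [] l≢0 = contradiction refl l≢0
  ∈-coloursAt {γ} s ((c , e) ∷ cs) l≢0 with γ Fin.≟ c
  ... | no _ = ∈-++⁺ʳ (replicate (half s e) c) (∈-coloursAt s cs l≢0)
  ... | yes refl with half s e
  ...   | zero  = ∈-coloursAt s cs l≢0
  ...   | suc _ = here refl

  -- Pigeonhole: otherwise all `k` colours would occur in a list of fewer than `k` entries.
  missingColour : ∀ s cs → halfdeg s (edges cs) < k → ∃ λ γ → load γ s cs ≡ 0
  missingColour s cs d<k with Fin.any? (λ γ → load γ s cs ≟ 0)
  ... | yes found = found
  ... | no none   = contradiction d<k (≤⇒≯ (subst₂ _≤_ (∣⊤∣≡n k) (length-coloursAt s cs)
                      (p⊆xs⇒∣p∣≤length {p = ⊤} (coloursAt s cs)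
                        λ {γ} _ → ∈-coloursAt s cs λ l≡0 → none (γ , l≡0))))

  module _ {α β : Fin k} (α≢β : α ≢ β) where

    -- The middle index orients the α- and β-edges between a left (inj₁) and a right
    -- (inj₂) copy of V: edges oriented left to right get colour α, the others β, so
    -- at a left vertex the loads of α and β are the out- and indegree, and at a
    -- right vertex the in- and outdegree.
    data Recolouring : Colouring → List ((V ⊎ V) × (V ⊎ V)) → Colouring → Set where
      []    : Recolouring [] [] []
      other : ∀ {c e cs os cs′} → α ≢ c → β ≢ c → Recolouring cs os cs′ →
              Recolouring ((c , e) ∷ cs) os ((c , e) ∷ cs′)
      forward : ∀ {c a b cs os cs′} → c ≡ α ⊎ c ≡ β → Recolouring cs os cs′ →
              Recolouring ((c , a , b) ∷ cs) ((inj₁ a , inj₂ b) ∷ os) ((α , a , b) ∷ cs′)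
      backward : ∀ {c a b cs os cs′} → c ≡ α ⊎ c ≡ β → Recolouring cs os cs′ →
              Recolouring ((c , a , b) ∷ cs) ((inj₂ b , inj₁ a) ∷ os) ((β , a , b) ∷ cs′)

    recolouring : ∀ cs → ∃ λ es → ∀ {os} → es ↝ os → ∃ (Recolouring cs os)
    recolouring [] = [] , λ { [] → _ , [] }
    recolouring ((c , a , b) ∷ cs)
      with α Fin.≟ c | β Fin.≟ c | recolouring cs
    ... | no α≢c   | no β≢c   | es , f = es , λ r → _ , other α≢c β≢c (proj₂ (f r))
    ... | yes refl | _        | es , f = (inj₁ a , inj₂ b) ∷ es , λ where
      (keep r) → _ , forward (inj₁ refl) (proj₂ (f r))
      (flip r) → _ , backward (inj₁ refl) (proj₂ (f r))
    ... | no _     | yes refl | es , f = (inj₁ a , inj₂ b) ∷ es , λ where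
      (keep r) → _ , forward (inj₂ refl) (proj₂ (f r))
      (flip r) → _ , backward (inj₂ refl) (proj₂ (f r))

    edges-recolouring : ∀ {cs os cs′} → Recolouring cs os cs′ → edges cs′ ≡ edges cs
    edges-recolouring []             = refl
    edges-recolouring (other _ _ r)  = cong (_ ∷_) (edges-recolouring r)
    edges-recolouring (forward _ r)  = cong (_ ∷_) (edges-recolouring r)
    edges-recolouring (backward _ r) = cong (_ ∷_) (edges-recolouring r)

    joint : V ⊎ V → Colouring → ℕ
    joint s cs = load α s cs + load β s cs

    joint-∷ : ∀ {c} → c ≡ α ⊎ c ≡ β → ∀ s e cs → joint s ((c , e) ∷ cs) ≡ half s e + joint s cs
    joint-∷ (inj₁ refl) s e cs =
      trans (cong₂ _+_ (load-≡ α s e cs) (load-≢ (α≢β ∘ sym) s e cs)) (+-assoc (half s e) _ _)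
    joint-∷ (inj₂ refl) s e cs =
      trans (cong₂ _+_ (load-≢ α≢β s e cs) (load-≡ β s e cs)) (x∙yz≈y∙xz (load α s cs) (half s e) _)

    joint-recolouring : ∀ s {cs os cs′} → Recolouring cs os cs′ → joint s cs′ ≡ joint s cs
    joint-recolouring s [] = refl
    joint-recolouring s (other {e = e} {cs} {cs′ = cs′} α≢c β≢c r) =
      trans (cong₂ _+_ (load-≢ α≢c s e cs′) (load-≢ β≢c s e cs′))
      (trans (joint-recolouring s r)
             (sym (cong₂ _+_ (load-≢ α≢c s e cs) (load-≢ β≢c s e cs))))
    joint-recolouring s (forward {c} {a} {b} {cs} {cs′ = cs′} c∈αβ r) =
      trans (joint-∷ (inj₁ refl) s (a , b) cs′)
      (trans (cong (half s (a , b) +_) (joint-recolouring s r)) (sym (joint-∷ c∈αβ s (a , b) cs)))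
    joint-recolouring s (backward {c} {a} {b} {cs} {cs′ = cs′} c∈αβ r) =
      trans (joint-∷ (inj₂ refl) s (a , b) cs′)
      (trans (cong (half s (a , b) +_) (joint-recolouring s r)) (sym (joint-∷ c∈αβ s (a , b) cs)))

    ≢-recoloured : ∀ {γ c} → γ ≢ α → γ ≢ β → c ≡ α ⊎ c ≡ β → γ ≢ c
    ≢-recoloured γ≢α _   (inj₁ refl) = γ≢α
    ≢-recoloured _   γ≢β (inj₂ refl) = γ≢β

    load-recolouring : ∀ {γ} → γ ≢ α → γ ≢ β → ∀ s {cs os cs′} → Recolouring cs os cs′ →
                 load γ s cs′ ≡ load γ s cs
    load-recolouring γ≢α γ≢β s [] = refl
    load-recolouring {γ} γ≢α γ≢β s (other {c} _ _ r) with γ Fin.≟ c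
    ... | yes _ = cong (_ +_) (load-recolouring γ≢α γ≢β s r)
    ... | no _  = load-recolouring γ≢α γ≢β s r
    load-recolouring γ≢α γ≢β s (forward {c} {a} {b} {cs} {cs′ = cs′} c∈αβ r) =
      trans (load-≢ γ≢α s (a , b) cs′)
      (trans (load-recolouring γ≢α γ≢β s r) (sym (load-≢ (≢-recoloured γ≢α γ≢β c∈αβ) s (a , b) cs)))
    load-recolouring γ≢α γ≢β s (backward {c} {a} {b} {cs} {cs′ = cs′} c∈αβ r) =
      trans (load-≢ γ≢β s (a , b) cs′)
      (trans (load-recolouring γ≢α γ≢β s r) (sym (load-≢ (≢-recoloured γ≢α γ≢β c∈αβ) s (a , b) cs)))

    loads-recolouring₁ : ∀ x {cs os cs′} → Recolouring cs os cs′ →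
      load α (inj₁ x) cs′ ≡ Bipartite.out (inj₁ x) os ×
      load β (inj₁ x) cs′ ≡ Bipartite.into (inj₁ x) os
    loads-recolouring₁ x [] = refl , refl
    loads-recolouring₁ x (other {e = e} {cs′ = cs′} α≢c β≢c r)
      rewrite load-≢ α≢c (inj₁ x) e cs′ | load-≢ β≢c (inj₁ x) e cs′ = loads-recolouring₁ x r
    loads-recolouring₁ x (forward {a = a} {b} {cs′ = cs′} _ r)
      rewrite load-≡ α (inj₁ x) (a , b) cs′ | load-≢ (α≢β ∘ sym) (inj₁ x) (a , b) cs′ =
      let p , q = loads-recolouring₁ x r in cong (δ x a +_) p , q
    loads-recolouring₁ x (backward {a = a} {b} {cs′ = cs′} _ r)
      rewrite load-≡ β (inj₁ x) (a , b) cs′ | load-≢ α≢β (inj₁ x) (a , b) cs′ =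
      let p , q = loads-recolouring₁ x r in p , cong (δ x a +_) q

    loads-recolouring₂ : ∀ y {cs os cs′} → Recolouring cs os cs′ →
      load α (inj₂ y) cs′ ≡ Bipartite.into (inj₂ y) os ×
      load β (inj₂ y) cs′ ≡ Bipartite.out (inj₂ y) os
    loads-recolouring₂ y [] = refl , refl
    loads-recolouring₂ y (other {e = e} {cs′ = cs′} α≢c β≢c r)
      rewrite load-≢ α≢c (inj₂ y) e cs′ | load-≢ β≢c (inj₂ y) e cs′ = loads-recolouring₂ y r
    loads-recolouring₂ y (forward {a = a} {b} {cs′ = cs′} _ r)
      rewrite load-≡ α (inj₂ y) (a , b) cs′ | load-≢ (α≢β ∘ sym) (inj₂ y) (a , b) cs′ =
      let p , q = loads-recolouring₂ y r in cong (δ y b +_) p , q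
    loads-recolouring₂ y (backward {a = a} {b} {cs′ = cs′} _ r)
      rewrite load-≡ β (inj₂ y) (a , b) cs′ | load-≢ α≢β (inj₂ y) (a , b) cs′ =
      let p , q = loads-recolouring₂ y r in p , cong (δ y b +_) q

    -- In place of the usual exchange along one alternating path, all edges of the two colours are
    -- recoloured at once.
    rebalance : ∀ cs → ∃ λ cs′ → edges cs′ ≡ edges cs
      × (∀ γ → γ ≢ α → γ ≢ β → ∀ s → load γ s cs′ ≡ load γ s cs)
      × (∀ s → joint s cs′ ≡ joint s cs)
      × (∀ s → Balanced (load α s cs′) (load β s cs′))
    rebalance cs with recolouring cs
    ... | es , f with Bipartite.balancedOrientation es
    ... | os , o , bal with f o
    ... | cs′ , r = cs′ , edges-recolouring r , (λ γ γ≢α γ≢β s → load-recolouring γ≢α γ≢β s r)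
                  , (λ s → joint-recolouring s r) , balanced
      where
      balanced : ∀ s → Balanced (load α s cs′) (load β s cs′)
      balanced (inj₁ x) = let p , q = loads-recolouring₁ x r in
        subst₂ Balanced (sym p) (sym q) (bal (inj₁ x))
      balanced (inj₂ y) = let p , q = loads-recolouring₂ y r in
        subst₂ Balanced (sym p) (sym q) (balanced-sym (bal (inj₂ y)))

  Proper : Colouring → Set
  Proper cs = ∀ γ s → load γ s cs ≤ 1

  insert : ∀ a b cs → halfdeg (inj₁ a) (edges cs) < k → halfdeg (inj₂ b) (edges cs) < k →
           Proper cs → ∃ λ cs′ → edges cs′ ≡ (a , b) ∷ edges cs × Proper cs′
  insert a b cs a<k b<k proper with missingColour (inj₁ a) cs a<k | missingColour (inj₂ b) cs b<k
  ... | α , α∉a | β , β∉b with α Fin.≟ β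
  ...   | yes refl = (α , a , b) ∷ cs , refl , proper′
    where
    fits : ∀ s → half s (a , b) + load α s cs ≤ 1
    fits (inj₁ x) with x ≟ⱽ a
    ... | yes refl = s≤s (≤-reflexive α∉a)
    ... | no _     = proper α (inj₁ x)
    fits (inj₂ y) with y ≟ⱽ b
    ... | yes refl = s≤s (≤-reflexive β∉b)
    ... | no _     = proper α (inj₂ y)

    proper′ : Proper ((α , a , b) ∷ cs)
    proper′ γ s with γ Fin.≟ α
    ... | yes refl = fits s
    ... | no _     = proper γ s
  -- The new edge gets `α`, which may already occur at `b`; rebalancing repairs this.
  ...   | no α≢β with rebalance α≢β ((α , a , b) ∷ cs)
  ...     | cs′ , edges≡ , other≡ , joint≡ , bal = cs′ , edges≡ , proper′
    where
    -- Before the insertion `α` is absent at the left copy of `a` and `β` at the right copy of `b`,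
    -- so each of these meets at most one edge of the two colours, and the new edge makes at most
    -- two.
    fits : ∀ s → half s (a , b) + joint α≢β s cs ≤ 2
    fits (inj₁ x) with x ≟ⱽ a
    ... | yes refl = s≤s (+-mono-≤ (≤-reflexive α∉a) (proper β (inj₁ x)))
    ... | no _     = +-mono-≤ (proper α (inj₁ x)) (proper β (inj₁ x))
    fits (inj₂ y) with y ≟ⱽ b
    ... | yes refl = s≤s (subst (λ l → load α (inj₂ y) cs + l ≤ 1) (sym β∉b)
                       (subst (_≤ 1) (sym (+-identityʳ _)) (proper α (inj₂ y))))
    ... | no _     = +-mono-≤ (proper α (inj₂ y)) (proper β (inj₂ y))

    joint≤2 : ∀ s → load α s cs′ + load β s cs′ ≤ 2
    joint≤2 s = subst (_≤ 2)
      (sym (trans (joint≡ s) (joint-∷ α≢β (inj₁ refl) s (a , b) cs))) (fits s)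

    proper′ : Proper cs′
    proper′ γ s with γ Fin.≟ α | γ Fin.≟ β
    ... | yes refl | _        = balanced⇒≤1 (bal s) (joint≤2 s)
    ... | no _     | yes refl = balanced⇒≤1 (balanced-sym (bal s))
                                  (subst (_≤ 2) (+-comm (load α s cs′) _) (joint≤2 s))
    ... | no γ≢α   | no γ≢β   = subst (_≤ 1)
      (sym (trans (other≡ γ γ≢α γ≢β s) (load-≢ γ≢α s (a , b) cs))) (proper γ s)

  properColouring : ∀ es → (∀ s → halfdeg s es ≤ k) → ∃ λ cs → edges cs ≡ es × Proper cs
  properColouring [] _ = [] , refl , λ _ _ → z≤n
  properColouring ((a , b) ∷ es) d≤k
    with properColouring es (λ s → m+n≤o⇒n≤o (half s (a , b)) (d≤k s))
  ... | cs , refl , proper =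
    insert a b cs
      -- The new edge counts once at each of its ends, so the remaining degrees there are below `k`.
      (subst (λ d → d + halfdeg (inj₁ a) es ≤ k) (δ-refl a) (d≤k (inj₁ a)))
      (subst (λ d → d + halfdeg (inj₂ b) es ≤ k) (δ-refl b) (d≤k (inj₂ b)))
      proper

-- Simple graphs as edge lists

Joins : {V : Set} → V → V → V × V → Set
Joins u v (a , b) = (u ≡ a × v ≡ b) ⊎ (u ≡ b × v ≡ a)

joins-sym : ∀ {V : Set} {u v : V} e → Joins u v e → Joins v u e
joins-sym _ (inj₁ (p , q)) = inj₂ (q , p)
joins-sym _ (inj₂ (p , q)) = inj₁ (q , p)

module Incidence {V : Set} (_≟ⱽ_ : DecidableEquality V) where
  open Orientation _≟ⱽ_

  joins? : ∀ u v e → Dec (Joins u v e)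
  joins? u v (a , b) = (u ≟ⱽ a ×-dec v ≟ⱽ b) ⊎-dec (u ≟ⱽ b ×-dec v ≟ⱽ a)

  joins-↝ : ∀ {u v es os} → es ↝ os → Any (Joins u v) es → Any (Joins u v) os
  joins-↝ (keep o) (here j)  = here j
  joins-↝ (flip o) (here j)  = here (swap j)
  joins-↝ (keep o) (there p) = there (joins-↝ o p)
  joins-↝ (flip o) (there p) = there (joins-↝ o p)

  -- Multiplicities are kept, so that the length is exactly the degree and bounds the number of
  -- distinct neighbours.
  partners : V → List (V × V) → List V
  partners x []             = []
  partners x ((a , b) ∷ es) = replicate (δ x a) b ++ replicate (δ x b) a ++ partners x es

  length-partners : ∀ x es → length (partners x es) ≡ degree x es
  length-partners x []             = refl
  length-partners x ((a , b) ∷ es) = begin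
    length (replicate (δ x a) b ++ replicate (δ x b) a ++ partners x es)
      ≡⟨ length-++ (replicate (δ x a) b) ⟩
    length (replicate (δ x a) b) + length (replicate (δ x b) a ++ partners x es)
      ≡⟨ cong₂ _+_ (length-replicate (δ x a)) (length-++ (replicate (δ x b) a)) ⟩
    δ x a + (length (replicate (δ x b) a) + length (partners x es))
      ≡⟨ cong (δ x a +_) (cong₂ _+_ (length-replicate (δ x b)) (length-partners x es)) ⟩
    δ x a + (δ x b + degree x es)
      ≡⟨ +-assoc (δ x a) (δ x b) _ ⟨
    δ x a + δ x b + degree x es
      ≡⟨ interchange (δ x a) (δ x b) (out x es) (into x es) ⟩
    degree x ((a , b) ∷ es) ∎
    where open ≡-Reasoning

  ∈-partners : ∀ {x y es} → Any (Joins x y) es → y List.∈ partners x es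
  ∈-partners {x} (here (inj₁ (refl , refl))) rewrite δ-refl x = here refl
  ∈-partners {x} {es = (a , b) ∷ _} (here (inj₂ (refl , refl))) =
    ∈-++⁺ʳ (replicate (δ x a) b) head∈
    where
    head∈ : ∀ {ys} → a List.∈ replicate (δ x x) a ++ ys
    head∈ rewrite δ-refl x = here refl
  ∈-partners {x} {es = (a , b) ∷ _} (there p) =
    ∈-++⁺ʳ (replicate (δ x a) b) (∈-++⁺ʳ (replicate (δ x b) a) (∈-partners p))

module _ {n : ℕ} where
  open Orientation (Fin._≟_ {n})
  open Incidence (Fin._≟_ {n})

  Ascending : Fin n × Fin n → Set
  Ascending (a , b) = a <ᶠ b

  ascending⇒¬joins : ∀ {a b es} → a <ᶠ b → All ((a , b) ≢_) es → All Ascending es →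
                     ¬ Any (Joins a b) es
  ascending⇒¬joins a<b (≢e ∷ _) _ (here (inj₁ (refl , refl))) = ≢e refl
  ascending⇒¬joins a<b _ (b<a ∷ _) (here (inj₂ (refl , refl))) = Fin.<-asym a<b b<a
  ascending⇒¬joins a<b (_ ∷ ≢es) (_ ∷ asc) (there p) = ascending⇒¬joins a<b ≢es asc p

  -- Peeling off an edge at `x` deletes its other end from `p`. By uniqueness and ascending order no
  -- later edge joins `x` to that end again.
  degree≤∣p∣ : ∀ x es (p : Subset n) → Unique es → All Ascending es →
               (∀ y → Any (Joins x y) es → y ∈ p) → degree x es ≤ ∣ p ∣
  degree≤∣p∣ x [] p _ _ _ = z≤n
  degree≤∣p∣ x ((a , b) ∷ es) p (≢es ∷ uniq) (a<b ∷ asc) joined⇒∈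
    with x Fin.≟ a | x Fin.≟ b
  ... | yes refl | yes refl = contradiction a<b (Fin.<-irrefl refl)
  ... | yes refl | no _     = ≤-trans
    (s≤s (degree≤∣p∣ x es (p - b) uniq asc λ y j → x∈p∧x≢y⇒x∈p-y (joined⇒∈ y (there j))
      λ { refl → ascending⇒¬joins a<b ≢es asc j }))
    (x∈p⇒∣p-x∣<∣p∣ (joined⇒∈ b (here (inj₁ (refl , refl)))))
  ... | no _     | yes refl = ≤-trans
    (≤-reflexive (+-suc (out x es) _))
    (≤-trans
      (s≤s (degree≤∣p∣ x es (p - a) uniq asc λ y j → x∈p∧x≢y⇒x∈p-y (joined⇒∈ y (there j))
        λ { refl → ascending⇒¬joins a<b ≢es asc (Any.map (λ {e} → joins-sym e) j) }))
      (x∈p⇒∣p-x∣<∣p∣ (joined⇒∈ a (here (inj₂ (refl , refl))))))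
  ... | no _     | no _     = degree≤∣p∣ x es p uniq asc λ y j → joined⇒∈ y (there j)

-- Colours of unordered pairs

module FirstColour {V : Set} (_≟ⱽ_ : DecidableEquality V) (k : ℕ) where
  open Incidence _≟ⱽ_
  open EdgeColouring _≟ⱽ_ (suc k)

  -- Reading off one colour per unordered pair makes the colour classes disjoint
  -- without having to know that no edge is listed twice.
  firstColour : Colouring → V → V → Fin (suc k)
  -- A default for pairs that no entry joins; it requires a colour to exist, hence `suc k`.
  firstColour []             u v = zero
  firstColour ((c , e) ∷ cs) u v = if does (joins? u v e) then c else firstColour cs u v

  firstColour-sym : ∀ cs u v → firstColour cs u v ≡ firstColour cs v u
  firstColour-sym []             u v = refl
  firstColour-sym ((c , e) ∷ cs) u v =
    cong₂ (λ joined d → if joined then c else d)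
          (does-⇔ (mk⇔ (joins-sym e) (joins-sym e)) (joins? u v e) (joins? v u e))
          (firstColour-sym cs u v)

  class-∷⁺ : ∀ {P : V × V → Set} γ {x} cs → Any P (class γ cs) → Any P (class γ (x ∷ cs))
  class-∷⁺ γ {c , _} cs p with γ Fin.≟ c
  ... | yes _ = there p
  ... | no _  = p

  class-here : ∀ {P : V × V → Set} γ {e} cs → P e → Any P (class γ ((γ , e) ∷ cs))
  class-here γ cs p with γ Fin.≟ γ
  ... | yes _  = here p
  ... | no γ≢γ = contradiction refl γ≢γ

  -- The entry that determines the colour lies in the class of that colour, and entries in front of
  -- it only enlarge classes.
  joins-firstColour : ∀ cs u v → Any (Joins u v) (edges cs) →
                      Any (Joins u v) (class (firstColour cs u v) cs)
  joins-firstColour ((c , e) ∷ cs) u v p with Dec.toSum (joins? u v e)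
  ... | inj₁ j  rewrite dec-true (joins? u v e) j   = class-here c cs j
  ... | inj₂ ¬j rewrite dec-false (joins? u v e) ¬j =
    class-∷⁺ (firstColour cs u v) cs (joins-firstColour cs u v (Any.tail ¬j p))

-- Semiregular partition of a simple graph

module _ {n : ℕ} (G : Graph n) where
  open Orientation (Fin._≟_ {n})
  open Incidence (Fin._≟_ {n})
  open EdgeColouring (Fin._≟_ {n}) ⌈ suc (Δ G) /2⌉
  -- `⌈ suc (Δ G) /2⌉` computes to `suc ⌊ Δ G /2⌋`, so the two modules share one set of colours.
  open FirstColour (Fin._≟_ {n}) ⌊ Δ G /2⌋

  isEdge? : ∀ (e : Fin n × Fin n) → Dec (Ascending e × Adj G (proj₁ e) (proj₂ e))
  isEdge? (a , b) = a Fin.<? b ×-dec b ∈? Graph.neighbours G a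

  edgeList : List (Fin n × Fin n)
  edgeList = filter isEdge? (cartesianProduct (allFin n) (allFin n))

  edgeList-unique : Unique edgeList
  edgeList-unique =
    Unique.filter⁺ isEdge? (Unique.cartesianProduct⁺ (Unique.allFin⁺ n) (Unique.allFin⁺ n))

  edgeList-edges : All (λ e → Ascending e × Adj G (proj₁ e) (proj₂ e)) edgeList
  edgeList-edges = all-filter isEdge? (cartesianProduct (allFin n) (allFin n))

  ∈-edgeList : ∀ {u v} → u <ᶠ v → Adj G u v → (u , v) List.∈ edgeList
  ∈-edgeList {u} {v} u<v adj =
    ∈-filter⁺ isEdge? (∈-cartesianProduct⁺ (∈-allFin u) (∈-allFin v)) (u<v , adj)

  joins-edgeList⁺ : ∀ {u v} → Adj G u v → Any (Joins u v) edgeList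
  joins-edgeList⁺ {u} {v} adj with Fin.<-cmp u v
  ... | tri< u<v _ _  = Any.map (λ { refl → inj₁ (refl , refl) }) (∈-edgeList u<v adj)
  ... | tri≈ _ refl _ = contradiction adj (Graph.loopless G)
  ... | tri> _ _ v<u  =
    Any.map (λ { refl → inj₂ (refl , refl) }) (∈-edgeList v<u (Graph.symmetric G adj))

  joins-edgeList⁻ : ∀ {u v} → Any (Joins u v) edgeList → Adj G u v
  joins-edgeList⁻ {u} {v} = All.lookupWith {R = λ _ → Adj G u v} (λ where
    (_ , adj) (inj₁ (refl , refl)) → adj
    (_ , adj) (inj₂ (refl , refl)) → Graph.symmetric G adj) edgeList-edges

  -- The maximum ranges over `vertices` only. A point with a neighbour lies there by `endpoint`; any
  -- other has degree 0.
  deg≤Δ : ∀ v → deg G v ≤ Δ G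
  deg≤Δ v with nonempty? (Graph.neighbours G v)
  ... | yes (w , adj) = All.lookup (xs≤max 0 (map (deg G) (Graph.vertexList G)))
    (∈-map⁺ (deg G) (∈-filter⁺ (_∈? Graph.vertices G) (∈-allFin v)
                                (Graph.endpoint G (Graph.symmetric G adj))))
  ... | no empty = subst (_≤ Δ G) (sym (trans (cong ∣_∣ (Empty-unique empty)) (∣⊥∣≡0 n))) z≤n

  degree-edgeList : ∀ x → degree x edgeList ≤ Δ G
  degree-edgeList x = ≤-trans
    (degree≤∣p∣ x edgeList (Graph.neighbours G x) edgeList-unique
                (All.map proj₁ edgeList-edges) (λ _ → joins-edgeList⁻))
    (deg≤Δ x)

  edgeColouring : ∃ λ cs → (∀ {u v} → Adj G u v → Any (Joins u v) (edges cs)) × Proper cs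
  edgeColouring with balancedOrientation edgeList
  -- From here on the arcs are bipartite edges: outdegree is the degree on the left, indegree on the
  -- right.
  ... | os , o , bal with properColouring os bounded
    where
    degree≤ : ∀ x → degree x os ≤ Δ G
    degree≤ x = subst (_≤ Δ G) (sym (degree-↝ x o)) (degree-edgeList x)

    bounded : ∀ s → halfdeg s os ≤ ⌈ suc (Δ G) /2⌉
    bounded (inj₁ x) = balanced⇒≤half (bal x) (degree≤ x)
    bounded (inj₂ x) = balanced⇒≤half (balanced-sym (bal x))
                         (subst (_≤ Δ G) (+-comm (out x os) _) (degree≤ x))
  ... | cs , refl , proper = cs , (λ adj → joins-↝ o (joins-edgeList⁺ adj)) , proper

  semiregularColouring : ∃[ m ] m ≤ ⌈ suc (Δ G) /2⌉ × PartitionsInto Semiregular G m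
  semiregularColouring with edgeColouring
  ... | cs , covered , proper =
    prune {Q = Semiregular} {G} _ colourClass
      (λ u v adj → firstColour cs u v , ∈-comprehension⁺ (inClass? _ u) (adj , refl))
      (λ i j u v p q → trans (sym (proj₂ (∈-comprehension⁻ (inClass? i u) p)))
                             (proj₂ (∈-comprehension⁻ (inClass? j u) q)))
      -- Every vertex of an induced subgraph has an edge there, so the degrees are 1 or 2.
      (λ i → 1 , λ v v∈ → one-or-two
        (nonempty⇒∣p∣≥1 (∈-comprehension⁻ (λ v → nonempty? (incident (colourClass i) v)) v∈))
        (∣class∣≤2 i v))
    where
    inClass? : ∀ i u v → Dec (Adj G u v × firstColour cs u v ≡ i)
    inClass? i u v = v ∈? Graph.neighbours G u ×-dec firstColour cs u v Fin.≟ i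

    colourClass : Fin ⌈ suc (Δ G) /2⌉ → EdgeSet G
    colourClass i = record
      { incident  = λ u → comprehension (inClass? i u)
      ; isSubset  = λ {u} v∈ → proj₁ (∈-comprehension⁻ (inClass? i u) v∈)
      ; symmetric = λ {u} {v} v∈ →
          let adj , eq = ∈-comprehension⁻ (inClass? i u) v∈
          in ∈-comprehension⁺ (inClass? i v)
               (Graph.symmetric G adj , trans (firstColour-sym cs v u) eq)
      }

    joined : ∀ i u {v} → v ∈ incident (colourClass i) u → Any (Joins u v) (class i cs)
    joined i u {v} v∈ with ∈-comprehension⁻ (inClass? i u) v∈
    ... | adj , refl = joins-firstColour cs u v (covered adj)

    -- Properness leaves at most one outgoing and one incoming arc of each colour.
    ∣class∣≤2 : ∀ i u → ∣ incident (colourClass i) u ∣ ≤ 2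
    ∣class∣≤2 i u = begin
      ∣ incident (colourClass i) u ∣
        ≤⟨ p⊆xs⇒∣p∣≤length (partners u (class i cs)) (∈-partners ∘ joined i u) ⟩
      length (partners u (class i cs))
        ≡⟨ length-partners u (class i cs) ⟩
      degree u (class i cs)
        ≤⟨ +-mono-≤ (proper i (inj₁ u)) (proper i (inj₂ u)) ⟩
      2 ∎
      where open ≤-Reasoning

    nonempty⇒∣p∣≥1 : ∀ {p : Subset n} → ∃ (_∈ p) → 1 ≤ ∣ p ∣
    nonempty⇒∣p∣≥1 (_ , x∈p) = ≤-trans (s≤s z≤n) (x∈p⇒∣p-x∣<∣p∣ x∈p)

    one-or-two : ∀ {d} → 1 ≤ d → d ≤ 2 → d ≡ 1 ⊎ d ≡ 2
    one-or-two {1} _ _ = inj₁ refl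
    one-or-two {2} _ _ = inj₂ refl
    one-or-two {suc (suc (suc _))} _ (s≤s (s≤s ()))

theorem3 : ∀ {n : ℕ} (G : Graph n) → HasEdge G →
    wr G ≤ sr G × sr G ≤ ⌈ suc (Δ G) /2⌉
theorem3 G _ =
    -- A minimum semiregular partition is also a weakly semiregular one.
    (let P , semiregular = proj₁ (proj₂ (leastSemiregular G))
     in proj₂ (proj₂ (leastWeaklySemiregular G)) (sr G)
          (P , λ i → semiregular⇒weaklySemiregular {G = induced (part P i)} (semiregular i)))
  , (let m , m≤k , partition = semiregularColouring G
     in ≤-trans (proj₂ (proj₂ (leastSemiregular G)) m partition) m≤k)
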